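{- Let $B$ be one of the boards $\{1,\ldots,n\}\times\{1,\ldots,n\}$ for some integer $n\ge 1$, $\mathbb{N}\times\mathbb{N}$, or $\mathbb{Z}\times\mathbb{Z}$. Then the Queen graph on $B$ has no odd independent set $S$ with $2\leq |S|<\infty$.
   Context: Here $\mathbb{N}=\{1,2,3,\ldots\}$. The Queen graph on a board $B\subseteq\mathbb{Z}\times\mathbb{Z}$ has vertex set $B$, and two distinct vertices $(a,b),(a',b')$ are adjacent iff $a=a'$, or $b=b'$, or $a-a'=b-b'$, or $a-a'=b'-b$. (The Queen graph of size $n$ is the one on $\{1,\ldots,n\}^2$; the infinite Queen graph is the one on the quarter plane $\mathbb{N}\times\mathbb{N}$ or on the whole plane $\mathbb{Z}\times\mathbb{Z}$.) For a graph $G=(V,E)$, $N(v)$ denotes the open neighborhood of $v$. A set $S\subseteq V$ is an odd independent set if it is independent (no two of its vertices are adjacent) and, for every vertex $v\in V\setminus S$, the set $N(v)\cap S$ is empty or of odd size. -}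

module Defs where

open import Level using (0ℓ)
open import Data.Nat using (ℕ)
import Data.Nat as ℕ
open import Data.Integer using (ℤ; +_; 1ℤ; -_; _-_; _≤_)
open import Data.Integer.Properties using (+-0-abelianGroup)
open import Data.List using (List; length)
import Data.List.Membership.Propositional as List
open import Data.List.Relation.Unary.Unique.Propositional using (Unique)
open import Data.Product using (_×_; _,_; ∃-syntax)
open import Data.Sum using (_⊎_; inj₁; inj₂)
open import Data.Unit using (⊤)
open import Function.Bundles using (_⇔_)
open import Relation.Binary.Core using (Rel)
open import Relation.Binary.Definitions using (Symmetric; Irreflexive)
open import Relation.Binary.PropositionalEquality
  using (_≡_; _≢_; refl; sym; trans; cong; ≢-sym)
open import Relation.Nullary using (¬_)
open import Relation.Unary using (Pred; _∈_; _∉_; _⊆_; _∩_; Empty)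
import Algebra.Properties.Group as GroupProperties
open import Algebra.Bundles using (AbelianGroup)

HasSize : {A : Set} → Pred A 0ℓ → ℕ → Set
HasSize {A} P k =
  ∃[ xs ] Unique xs × length xs ≡ k × (∀ (x : A) → x List.∈ xs ⇔ x ∈ P)

Odd : ℕ → Set
Odd k = ∃[ m ] k ≡ 1 ℕ.+ 2 ℕ.* m

-- A simple graph whose vertex set V is a subset of an ambient type A.
-- The relation _~_ is given on all of A; only its restriction to V matters.
record Graph (A : Set) : Set₁ where
  field
    V        : Pred A 0ℓ
    _~_      : Rel A 0ℓ
    ~-sym    : Symmetric _~_
    ~-irrefl : Irreflexive _≡_ _~_

  N : A → Pred A 0ℓ
  N v w = w ∈ V × v ~ w

record OddIndependent {A : Set} (G : Graph A) (S : Pred A 0ℓ) : Set where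
  open Graph G
  field
    subset      : S ⊆ V
    independent : ∀ {u v} → u ∈ S → v ∈ S → ¬ (u ~ v)
    emptyOrOdd  : ∀ {v} → v ∈ V → v ∉ S →
                  Empty (N v ∩ S) ⊎ (∃[ k ] Odd k × HasSize (N v ∩ S) k)

data Board : Set where
  square       : (n : ℕ) → 1 ℕ.≤ n → Board
  quarterPlane : Board
  plane        : Board

cells : Board → Pred (ℤ × ℤ) 0ℓ
cells (square n _) (a , b) = (1ℤ ≤ a × a ≤ + n) × (1ℤ ≤ b × b ≤ + n)
cells quarterPlane (a , b) = 1ℤ ≤ a × 1ℤ ≤ b
cells plane        _       = ⊤

QueenAdjacent : Rel (ℤ × ℤ) 0ℓ
QueenAdjacent (a , b) (a′ , b′) =
  (a , b) ≢ (a′ , b′) ×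
  (a ≡ a′ ⊎ b ≡ b′ ⊎ a - a′ ≡ b - b′ ⊎ a - a′ ≡ b′ - b)

private
  neg-sub : ∀ x y → - (x - y) ≡ y - x
  neg-sub = GroupProperties.⁻¹-anti-homo-// (AbelianGroup.group +-0-abelianGroup)

  swap-sub : ∀ x y z w → x - y ≡ z - w → y - x ≡ w - z
  swap-sub x y z w eq =
    trans (sym (neg-sub x y)) (trans (cong -_ eq) (neg-sub z w))

  queen-sym : Symmetric QueenAdjacent
  queen-sym (ne , inj₁ e)                      = ≢-sym ne , inj₁ (sym e)
  queen-sym (ne , inj₂ (inj₁ e))               = ≢-sym ne , inj₂ (inj₁ (sym e))
  queen-sym {a , b} {a′ , b′} (ne , inj₂ (inj₂ (inj₁ e))) =
    ≢-sym ne , inj₂ (inj₂ (inj₁ (swap-sub a a′ b b′ e)))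
  queen-sym {a , b} {a′ , b′} (ne , inj₂ (inj₂ (inj₂ e))) =
    ≢-sym ne , inj₂ (inj₂ (inj₂ (swap-sub a a′ b′ b e)))

queenGraph : Board → Graph (ℤ × ℤ)
queenGraph B = record
  { V        = cells B
  ; _~_      = QueenAdjacent
  ; ~-sym    = queen-sym
  ; ~-irrefl = λ { eq (ne , _) → ne eq }
  }

{-# OPTIONS --safe #-}

-- Since S is finite, the board may be cut down to a square window, and we may assume that
-- the bounding box of S is at least as high as it is wide, and that the window has exactly
-- the height m of the box. Let k = |S|, and write t, b for the queens on the top and bottom
-- row of the window. By parity, in each of these two rows every column of S is hit by a
-- diagonal or antidiagonal of S (at t and b, by both). Hence these lines hit the two rows at
-- least 2(k + 1) times in total. But each of these 2k lines hits the two rows exactly once,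
-- except for the two main diagonals of the window, which hit them twice. So everything is
-- tight: both main diagonals are occupied, hence so are the columns of the corners, so that
-- the bounding box is the window and the left and right columns are tight too. Summing
-- column numbers over all hits gives x_t + x_b ≡ 0 (mod m), so x_t + x_b = m. Now the cell
-- (0 , x_b) lies on a diagonal of t and on an antidiagonal of b, which contradicts tightness
-- on the left.
module Submission where

open import Defs
open import Level using (0ℓ)
open import Algebra.Bundles using (AbelianGroup)
import Algebra.Properties.Group as GroupProperties
open import Data.Bool using (if_then_else_)
open import Data.Empty using (⊥)
open import Data.Integer as ℤ using (ℤ; -[1+_]; ∣_∣; 1ℤ)
import Data.Integer.Properties as ℤ
open import Data.Integer.Tactic.RingSolver using () renaming (solve-∀ to ℤ-solve-∀)
open import Data.List using (List; []; _∷_; map; length; upTo)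
import Data.List.Membership.DecPropositional as DecMembership
open import Data.List.Membership.Propositional using (_∈_; _∉_)
open import Data.List.Membership.Propositional.Properties using (∈-upTo⁺; ∈-upTo⁻)
open import Data.List.Relation.Unary.All as All using (All)
open import Data.List.Relation.Unary.AllPairs using ([]; _∷_)
open import Data.List.Relation.Unary.Any using (here; there)
open import Data.List.Relation.Unary.Unique.Propositional using (Unique)
open import Data.List.Relation.Unary.Unique.Propositional.Properties using (upTo⁺)
open import Data.Nat
open import Data.Nat.Divisibility using (_∣_; divides; ∣m+n∣m⇒∣n; m∣m*n; n∣m*n)
open import Data.Nat.ListAction using (sum)
open import Data.Nat.Properties
open import Data.Nat.Tactic.RingSolver using (solve-∀)
open import Data.List.Extrema ≤-totalOrder
open import Data.Product using (_×_; _,_; proj₁; proj₂; ∃-syntax; Σ-syntax)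
open import Data.Product.Properties using (≡-dec)
open import Data.Sum using (_⊎_; inj₁; inj₂)
open import Data.Unit using (tt)
open import Function using (_∘_; id; const)
open import Function.Bundles using (Equivalence; mk⇔)
open import Relation.Binary.Definitions using (DecidableEquality; tri<; tri≈; tri>)
open import Relation.Binary.PropositionalEquality
open import Relation.Nullary using (¬_; Dec; yes; no; does; contradiction)
open import Relation.Nullary.Decidable using (decidable-stable)
open import Relation.Unary using (Pred; _∩_)

-- Finite sums of natural numbers

private variable
  A B : Set

-- Opaque, since otherwise unification unfolds the decision procedures and the sums over ranges.
opaque
  ⟦_⟧ : {P : Set} → Dec P → ℕ
  ⟦ P? ⟧ = if does P? then 1 else 0

  ⟦⟧-yes : {P : Set} (P? : Dec P) → P → ⟦ P? ⟧ ≡ 1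
  ⟦⟧-yes (yes _) _ = refl
  ⟦⟧-yes (no ¬p) p = contradiction p ¬p

  ⟦⟧-no : {P : Set} (P? : Dec P) → ¬ P → ⟦ P? ⟧ ≡ 0
  ⟦⟧-no (yes p) ¬p = contradiction p ¬p
  ⟦⟧-no (no _)  _  = refl

  ⟦⟧-cong : {P Q : Set} (P? : Dec P) (Q? : Dec Q) → (P → Q) → (Q → P) → ⟦ P? ⟧ ≡ ⟦ Q? ⟧
  ⟦⟧-cong (yes p) Q? f _ = sym (⟦⟧-yes Q? (f p))
  ⟦⟧-cong (no ¬p) Q? _ g = sym (⟦⟧-no Q? (¬p ∘ g))

  ⟦⟧≤1 : {P : Set} (P? : Dec P) → ⟦ P? ⟧ ≤ 1
  ⟦⟧≤1 (yes _) = ≤-refl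
  ⟦⟧≤1 (no _)  = z≤n

  ∑ : List A → (A → ℕ) → ℕ
  ∑ xs f = sum (map f xs)

  ∑-cong : ∀ xs {f g : A → ℕ} → (∀ {x} → x ∈ xs → f x ≡ g x) → ∑ xs f ≡ ∑ xs g
  ∑-cong []       eq = refl
  ∑-cong (x ∷ xs) eq = cong₂ _+_ (eq (here refl)) (∑-cong xs (eq ∘ there))

  ∑-mono : ∀ xs {f g : A → ℕ} → (∀ {x} → x ∈ xs → f x ≤ g x) → ∑ xs f ≤ ∑ xs g
  ∑-mono []       le = z≤n
  ∑-mono (x ∷ xs) le = +-mono-≤ (le (here refl)) (∑-mono xs (le ∘ there))

  ∑-+ : ∀ xs (f g : A → ℕ) → ∑ xs (λ x → f x + g x) ≡ ∑ xs f + ∑ xs g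
  ∑-+ []       f g = refl
  ∑-+ (x ∷ xs) f g = trans (cong (f x + g x +_) (∑-+ xs f g)) (interchange (f x) (g x) _ _)
    where
    interchange : ∀ a b c d → a + b + (c + d) ≡ a + c + (b + d)
    interchange = solve-∀

  ∑-*ˡ : ∀ xs c (f : A → ℕ) → ∑ xs (λ x → c * f x) ≡ c * ∑ xs f
  ∑-*ˡ []       c f = sym (*-zeroʳ c)
  ∑-*ˡ (x ∷ xs) c f = trans (cong (c * f x +_) (∑-*ˡ xs c f)) (sym (*-distribˡ-+ c (f x) _))

  ∑-const : ∀ (xs : List A) c → ∑ xs (λ _ → c) ≡ length xs * c
  ∑-const []       c = refl
  ∑-const (_ ∷ xs) c = cong (c +_) (∑-const xs c)

  ∑-swap : ∀ (xs : List A) (ys : List B) (f : A → B → ℕ) →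
           ∑ xs (λ x → ∑ ys (f x)) ≡ ∑ ys (λ y → ∑ xs (λ x → f x y))
  ∑-swap []       ys f = sym (trans (∑-const ys 0) (*-zeroʳ (length ys)))
  ∑-swap (x ∷ xs) ys f =
    trans (cong (∑ ys (f x) +_) (∑-swap xs ys f)) (sym (∑-+ ys (f x) _))

  ∑-*-+ : ∀ xs (w f g : A → ℕ) →
          ∑ xs (λ x → w x * (f x + g x)) ≡ ∑ xs (λ x → w x * f x) + ∑ xs (λ x → w x * g x)
  ∑-*-+ xs w f g = trans (∑-cong xs λ {x} _ → *-distribˡ-+ (w x) (f x) (g x))
                         (∑-+ xs (λ x → w x * f x) (λ x → w x * g x))

  ∑-zero : ∀ xs {f : A → ℕ} → (∀ {x} → x ∈ xs → f x ≡ 0) → ∑ xs f ≡ 0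
  ∑-zero xs eq = trans (∑-cong xs eq) (trans (∑-const xs 0) (*-zeroʳ (length xs)))

  ∑-term : ∀ {xs} {x : A} (f : A → ℕ) → x ∈ xs → f x ≤ ∑ xs f
  ∑-term f (here refl) = m≤m+n _ _
  ∑-term f (there x∈)  = m≤n⇒m≤o+n _ (∑-term f x∈)

  -- No term of `f` can make up for a deficit in another one, so equal totals leave no slack
  -- anywhere.
  ∑-tight : ∀ xs {f g : A → ℕ} → (∀ {x} → x ∈ xs → f x ≤ g x) → ∑ xs g ≤ ∑ xs f →
            ∀ {x} → x ∈ xs → f x ≡ g x
  ∑-tight (y ∷ ys) {f} {g} le tot = λ where
      (here refl) → ≤-antisym (le (here refl))
                      (+-cancelʳ-≤ (∑ ys f) (g y) (f y) (≤-trans (+-monoʳ-≤ (g y) rest) tot))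
      (there x∈)  → ∑-tight ys (le ∘ there)
                      (+-cancelˡ-≤ (f y) _ _ (≤-trans (+-monoˡ-≤ (∑ ys g) (le (here refl))) tot)) x∈
    where
    rest : ∑ ys f ≤ ∑ ys g
    rest = ∑-mono ys (le ∘ there)

  -- Bounds the number of queens on a line: once the head satisfies `P`, uniqueness makes every
  -- later term vanish.
  ∑-⟦⟧-≤1 : ∀ {xs} {P : A → Set} (P? : ∀ x → Dec (P x)) → Unique xs →
            (∀ {x y} → x ∈ xs → y ∈ xs → P x → P y → x ≡ y) → ∑ xs (λ x → ⟦ P? x ⟧) ≤ 1
  ∑-⟦⟧-≤1 P? [] inj = z≤n
  ∑-⟦⟧-≤1 {xs = x ∷ xs} P? (x∉ ∷ xs!) inj with P? x
  ... | no _  = ∑-⟦⟧-≤1 P? xs! λ y∈ z∈ → inj (there y∈) (there z∈)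
  ... | yes p = ≤-reflexive (cong suc (∑-zero xs λ {y} y∈ → ⟦⟧-no (P? y) λ q →
                  All.lookup x∉ y∈ (inj (here refl) (there y∈) p q)))

  ∑-⟦⟧-witness : ∀ xs {P : A → Set} (P? : ∀ x → Dec (P x)) → 1 ≤ ∑ xs (λ x → ⟦ P? x ⟧) →
                 ∃[ x ] x ∈ xs × P x
  ∑-⟦⟧-witness (x ∷ xs) P? pos with P? x
  ... | yes p = x , here refl , p
  ... | no _  with y , y∈ , q ← ∑-⟦⟧-witness xs P? pos = y , there y∈ , q

module _ (_≟ᴬ_ : DecidableEquality A) where

  opaque
    unfolding ∑

    ∑-δ-∉ : ∀ {xs} (w : A → ℕ) {s} → s ∉ xs → ∑ xs (λ x → w x * ⟦ s ≟ᴬ x ⟧) ≡ 0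
    ∑-δ-∉ {xs} w {s} s∉ = ∑-zero xs λ {x} x∈ →
      trans (cong (w x *_) (⟦⟧-no (s ≟ᴬ x) λ { refl → s∉ x∈ })) (*-zeroʳ (w x))

    ∑-δ-∈ : ∀ {xs} (w : A → ℕ) {s} → Unique xs → s ∈ xs → ∑ xs (λ x → w x * ⟦ s ≟ᴬ x ⟧) ≡ w s
    ∑-δ-∈ w {s} (x∉ ∷ _) (here refl) = trans
      (cong₂ _+_ (trans (cong (w s *_) (⟦⟧-yes (s ≟ᴬ s) refl)) (*-identityʳ (w s)))
                 (∑-δ-∉ w λ s∈ → All.lookup x∉ s∈ refl))
      (+-identityʳ (w s))
    ∑-δ-∈ {x ∷ xs} w {s} (x∉ ∷ xs!) (there s∈) = cong₂ _+_
      (trans (cong (w x *_) (⟦⟧-no (s ≟ᴬ x) λ { refl → All.lookup x∉ s∈ refl })) (*-zeroʳ (w x)))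
      (∑-δ-∈ w xs! s∈)

-- Elementary arithmetic

≡0-or-≡1 : ∀ {n} → n ≤ 1 → n ≡ 0 ⊎ n ≡ 1
≡0-or-≡1 z≤n       = inj₁ refl
≡0-or-≡1 (s≤s z≤n) = inj₂ refl

m∣n⇒n≡m : ∀ {m n} → m ∣ n → 0 < n → n < m + m → n ≡ m
m∣n⇒n≡m         (divides 0 refl)             0<n _   = contradiction 0<n (<-irrefl refl)
m∣n⇒n≡m {m}     (divides 1 refl)             _   _   = +-identityʳ m
m∣n⇒n≡m {m}     (divides (suc (suc q)) refl) _   n<  =
  contradiction (<-≤-trans n< (+-monoʳ-≤ m (m≤m+n m (q * m)))) (<-irrefl refl)

m+n≡l+o∧m≤l∧n≤o⇒m≡l : ∀ {m n l o} → m ≤ l → n ≤ o → m + n ≡ l + o → m ≡ l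
m+n≡l+o∧m≤l∧n≤o⇒m≡l {m} {n} {l} {o} m≤l n≤o eq = ≤-antisym m≤l
  (+-cancelʳ-≤ o l m (≤-trans (≤-reflexive (sym eq)) (+-monoʳ-≤ m n≤o)))

m<n⇒∃[o]o+m≡n : ∀ {m n} → m < n → ∃[ o ] o + m ≡ n
m<n⇒∃[o]o+m≡n {m} {n} m<n = n ∸ m , m∸n+n≡m (<⇒≤ m<n)

-- Tightness on two rows

-- The columns in which a line with x + y = s meets the rows y = m and y = 0
-- of the square [0,m]², weighted by w.
crossings : ℕ → (ℕ → ℕ) → ℕ → ℕ
crossings m w s = ∑ (upTo (suc m)) (λ i → w i * (⟦ s ≟ i + m ⟧ + ⟦ s ≟ i ⟧))

module _ {m : ℕ} (w : ℕ → ℕ) where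

  private
    I : List ℕ
    I = upTo (suc m)

    crossings-+ : ∀ s → crossings m w s ≡
      ∑ I (λ i → w i * ⟦ s ≟ i + m ⟧) + ∑ I (λ i → w i * ⟦ s ≟ i ⟧)
    crossings-+ s = ∑-*-+ I w (λ i → ⟦ s ≟ i + m ⟧) (λ i → ⟦ s ≟ i ⟧)

    top-< : ∀ {s} → s < m → ∑ I (λ i → w i * ⟦ s ≟ i + m ⟧) ≡ 0
    top-< {s} s<m = ∑-zero I λ {i} _ →
      trans (cong (w i *_) (⟦⟧-no (s ≟ i + m) λ { refl → m+n≮n i m s<m })) (*-zeroʳ (w i))

    top-≥ : ∀ {d} → d ≤ m → ∑ I (λ i → w i * ⟦ d + m ≟ i + m ⟧) ≡ w d
    top-≥ {d} d≤m = trans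
      (∑-cong I λ {i} _ → cong (w i *_)
        (⟦⟧-cong (d + m ≟ i + m) (d ≟ i) (+-cancelʳ-≡ m d i) (cong (_+ m))))
      (∑-δ-∈ _≟_ w (upTo⁺ _) (∈-upTo⁺ (s≤s d≤m)))

    bottom-≤ : ∀ {s} → s ≤ m → ∑ I (λ i → w i * ⟦ s ≟ i ⟧) ≡ w s
    bottom-≤ s≤m = ∑-δ-∈ _≟_ w (upTo⁺ _) (∈-upTo⁺ (s≤s s≤m))

    bottom-> : ∀ {s} → m < s → ∑ I (λ i → w i * ⟦ s ≟ i ⟧) ≡ 0
    bottom-> m<s = ∑-δ-∉ _≟_ w λ s∈ → <⇒≱ m<s (≤-pred (∈-upTo⁻ s∈))

  crossings-< : ∀ {s} → s < m → crossings m w s ≡ w s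
  crossings-< {s} s<m = trans (crossings-+ s) (cong₂ _+_ (top-< {s} s<m) (bottom-≤ {s} (<⇒≤ s<m)))

  crossings-≡ : crossings m w m ≡ w 0 + w m
  crossings-≡ = trans (crossings-+ m) (cong₂ _+_ (top-≥ {0} z≤n) (bottom-≤ ≤-refl))

  crossings-> : ∀ {d} → 0 < d → d ≤ m → crossings m w (d + m) ≡ w d
  crossings-> {d} 0<d d≤m = trans (crossings-+ (d + m))
    (trans (cong₂ _+_ (top-≥ d≤m) (bottom-> {d + m} (+-monoˡ-< m 0<d))) (+-identityʳ (w d)))

-- Below `m` the line meets only the bottom row, above `m` only the top row; for `s ≡ m` it joins
-- two corners.
crossings-count : ∀ {m s} → s ≤ m + m → crossings m (const 1) s ≡ 1 + ⟦ s ≟ m ⟧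
crossings-count {m} {s} s≤ with <-cmp s m
... | tri< s<m _ _ =
  trans (crossings-< (const 1) s<m) (cong suc (sym (⟦⟧-no (s ≟ m) (<⇒≢ s<m))))
... | tri≈ _ refl _ =
  trans (crossings-≡ {m} (const 1)) (cong suc (sym (⟦⟧-yes (m ≟ m) refl)))
... | tri> _ _ m<s with d , refl ← m<n⇒∃[o]o+m≡n m<s =
  trans (crossings-> (const 1) (+-cancelʳ-< m 0 d m<s) (+-cancelʳ-≤ m d m s≤))
        (cong suc (sym (⟦⟧-no (d + m ≟ m) (≢-sym (<⇒≢ m<s)))))

-- Column numbers determine `s` modulo `m`: the column is `s` below `m` and `s ∸ m` above, and the
-- two corner columns 0 and `m` add up to `s` itself.
crossings-sum : ∀ {m s} → s ≤ m + m → crossings m id s + m * ⟦ m <? s ⟧ ≡ s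
crossings-sum {m} {s} s≤ with <-cmp s m
... | tri< s<m _ m≮s
  rewrite crossings-< id s<m | ⟦⟧-no (m <? s) m≮s | *-zeroʳ m = +-identityʳ s
... | tri≈ _ refl m≮m
  rewrite crossings-≡ {m} id | ⟦⟧-no (m <? m) m≮m | *-zeroʳ m = +-identityʳ m
... | tri> _ _ m<s with d , refl ← m<n⇒∃[o]o+m≡n m<s
  rewrite crossings-> id (+-cancelʳ-< m 0 d m<s) (+-cancelʳ-≤ m d m s≤)
        | ⟦⟧-yes (m <? d + m) m<s | *-identityʳ m = refl

-- Lines through a cell and odd placements of queens

module Lines {P : Set} (xs : List P) (X Y : P → ℕ) where

  col row : ℕ → ℕ
  col i = ∑ xs λ q → ⟦ X q ≟ i ⟧
  row j = ∑ xs λ q → ⟦ Y q ≟ j ⟧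

  anti diag : ℕ → ℕ → ℕ
  anti i j = ∑ xs λ q → ⟦ X q + Y q ≟ i + j ⟧
  diag i j = ∑ xs λ q → ⟦ X q + j ≟ i + Y q ⟧

  attackers : ℕ → ℕ → ℕ
  attackers i j = col i + row j + (anti i j + diag i j)

-- The queens are abstract and only the coordinates X, Y vary, so that transposing the board
-- or moving the window leaves the list untouched.
record OddQueens {P : Set} (xs : List P) (m : ℕ) (X Y : P → ℕ) : Set where
  open Lines xs X Y
  field
    xs!   : Unique xs
    X≤m   : ∀ {q} → q ∈ xs → X q ≤ m
    Y≤m   : ∀ {q} → q ∈ xs → Y q ≤ m
    col!  : ∀ {p q} → p ∈ xs → q ∈ xs → X p ≡ X q → p ≡ q
    row!  : ∀ {p q} → p ∈ xs → q ∈ xs → Y p ≡ Y q → p ≡ q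
    anti! : ∀ {p q} → p ∈ xs → q ∈ xs → X p + Y p ≡ X q + Y q → p ≡ q
    diag! : ∀ {p q} → p ∈ xs → q ∈ xs → X p + Y q ≡ X q + Y p → p ≡ q
    odd   : ∀ {i j} → i ≤ m → j ≤ m → (∀ {q} → q ∈ xs → X q ≡ i → Y q ≢ j) →
            attackers i j ≡ 0 ⊎ ∃[ h ] attackers i j ≡ 1 + 2 * h

transpose : ∀ {P : Set} {xs : List P} {m X Y} → OddQueens xs m X Y → OddQueens xs m Y X
transpose {xs = xs} {m} {X} {Y} C = record
  { xs!   = xs!
  ; X≤m   = Y≤m
  ; Y≤m   = X≤m
  ; col!  = row!
  ; row!  = col!
  ; anti! = λ {p} {q} p∈ q∈ eq →
      anti! p∈ q∈ (trans (+-comm (X p) (Y p)) (trans eq (+-comm (Y q) (X q))))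
  ; diag! = λ {p} {q} p∈ q∈ eq →
      diag! p∈ q∈ (trans (+-comm (X p) (Y q)) (trans (sym eq) (+-comm (Y p) (X q))))
  ; odd   = λ {i} {j} i≤ j≤ free → subst (λ n → n ≡ 0 ⊎ ∃[ h ] n ≡ 1 + 2 * h) (attackers-comm i j)
      (odd j≤ i≤ λ q∈ x y → free q∈ y x)
  }
  where
  open OddQueens C
  module L  = Lines xs X Y
  module L′ = Lines xs Y X

  anti-comm : ∀ i j → L.anti j i ≡ L′.anti i j
  anti-comm i j = ∑-cong xs λ {q} _ → cong₂ (λ a b → ⟦ a ≟ b ⟧) (+-comm (X q) (Y q)) (+-comm j i)

  diag-comm : ∀ i j → L.diag j i ≡ L′.diag i j
  diag-comm i j = ∑-cong xs λ {q} _ → ⟦⟧-cong (X q + i ≟ j + Y q) (Y q + j ≟ i + X q)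
    (λ eq → trans (+-comm (Y q) j) (trans (sym eq) (+-comm (X q) i)))
    (λ eq → trans (+-comm (X q) i) (trans (sym eq) (+-comm (Y q) j)))

  attackers-comm : ∀ i j → L.attackers j i ≡ L′.attackers i j
  attackers-comm i j =
    cong₂ _+_ (+-comm (L.col j) (L.row i)) (cong₂ _+_ (anti-comm i j) (diag-comm i j))

-- Double counting on the top and bottom rows

module TopBottom {P : Set} {xs : List P} {m : ℕ} {X Y : P → ℕ} (C : OddQueens xs m X Y)
  {t b : P} (t∈ : t ∈ xs) (Yt : Y t ≡ m) (b∈ : b ∈ xs) (Yb : Y b ≡ 0) where

  open OddQueens C
  open Lines xs X Y

  private
    I : List ℕ
    I = upTo (suc m)

    k : ℕ
    k = length xs

    ∈I⁻ : ∀ {i} → i ∈ I → i ≤ m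
    ∈I⁻ i∈ = ≤-pred (∈-upTo⁻ i∈)

    ∈I⁺ : ∀ {i} → i ≤ m → i ∈ I
    ∈I⁺ i≤m = ∈-upTo⁺ (s≤s i≤m)

  col≤1 : ∀ i → col i ≤ 1
  col≤1 i = ∑-⟦⟧-≤1 (λ q → X q ≟ i) xs! λ p∈ q∈ ep eq → col! p∈ q∈ (trans ep (sym eq))

  row≡1 : ∀ {p} → p ∈ xs → row (Y p) ≡ 1
  row≡1 {p} p∈ = ≤-antisym
    (∑-⟦⟧-≤1 (λ q → Y q ≟ Y p) xs! λ q∈ r∈ eq er → row! q∈ r∈ (trans eq (sym er)))
    (subst (_≤ row (Y p)) (⟦⟧-yes (Y p ≟ Y p) refl) (∑-term (λ q → ⟦ Y q ≟ Y p ⟧) p∈))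

  1≤anti : ∀ {q i j} → q ∈ xs → X q + Y q ≡ i + j → 1 ≤ anti i j
  1≤anti {q} {i} {j} q∈ eq = subst (_≤ anti i j) (⟦⟧-yes (X q + Y q ≟ i + j) eq)
    (∑-term (λ q → ⟦ X q + Y q ≟ i + j ⟧) q∈)

  1≤diag : ∀ {q i j} → q ∈ xs → X q + j ≡ i + Y q → 1 ≤ diag i j
  1≤diag {q} {i} {j} q∈ eq = subst (_≤ diag i j) (⟦⟧-yes (X q + j ≟ i + Y q) eq)
    (∑-term (λ q → ⟦ X q + j ≟ i + Y q ⟧) q∈)

  -- A free cell of the row of p is attacked along that row, so by parity it cannot be
  -- attacked along its column without also being attacked along a diagonal.
  row-bound : ∀ {p i j} → p ∈ xs → Y p ≡ j → i ≤ m → col i + ⟦ X p ≟ i ⟧ ≤ anti i j + diag i j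
  row-bound {p} {i} p∈ refl i≤m with X p ≟ i
  -- At `p` itself parity says nothing; the antidiagonal and the diagonal of `p` pay for the column
  -- and for the extra unit.
  ... | yes refl = +-mono-≤ (≤-trans (col≤1 (X p)) (1≤anti {i = X p} p∈ refl))
                          (≤-trans (⟦⟧≤1 _) (1≤diag {i = X p} p∈ refl))
  ... | no Xp≢i rewrite ⟦⟧-no (no Xp≢i) Xp≢i | +-identityʳ (col i) with ≡0-or-≡1 (col≤1 i)
  ...   | inj₁ col≡0 rewrite col≡0 = z≤n
  ...   | inj₂ col≡1 with odd i≤m (Y≤m p∈) (λ q∈ x y → Xp≢i (trans (cong X (row! p∈ q∈ (sym y))) x))
  ...     | inj₁ none rewrite row≡1 p∈ | col≡1 = contradiction none λ ()
  ...     | inj₂ (h , eq) rewrite row≡1 p∈ | col≡1 with anti i (Y p) + diag i (Y p)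
  ...       | suc _ = s≤s z≤n
  -- Column and row alone make two attackers, whereas `1 + 2 * h` is 1 or at least 3.
  ...       | zero with suc h ← h =
    contradiction (suc-injective (suc-injective (trans eq (cong suc (*-suc 2 h))))) λ ()

  -- Demand and supply in column `i`: the two sides of `row-bound`, added over the rows of `t` and
  -- `b`.
  ends rays : ℕ → ℕ
  ends i = (col i + ⟦ X t ≟ i ⟧) + (col i + ⟦ X b ≟ i ⟧)
  rays i = (anti i m + diag i m) + (anti i 0 + diag i 0)

  top-bound : ∀ {i} → i ≤ m → col i + ⟦ X t ≟ i ⟧ ≤ anti i m + diag i m
  top-bound = row-bound t∈ Yt

  bottom-bound : ∀ {i} → i ≤ m → col i + ⟦ X b ≟ i ⟧ ≤ anti i 0 + diag i 0
  bottom-bound = row-bound b∈ Yb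

  ends≤rays : ∀ {i} → i ≤ m → ends i ≤ rays i
  ends≤rays i≤m = +-mono-≤ (top-bound i≤m) (bottom-bound i≤m)

  -- Line numbers of the two families. Since `s′` is `s` after turning the window upside down,
  -- `crossings` serves for both; the truncated subtraction is exact by `Y≤m`.
  s s′ : P → ℕ
  s  q = X q + Y q
  s′ q = X q + (m ∸ Y q)

  s≤ : ∀ {q} → q ∈ xs → s q ≤ m + m
  s≤ q∈ = +-mono-≤ (X≤m q∈) (Y≤m q∈)

  s′≤ : ∀ {q} → q ∈ xs → s′ q ≤ m + m
  s′≤ {q} q∈ = +-mono-≤ (X≤m q∈) (m∸n≤m m (Y q))

  s′+Y : ∀ {q} → q ∈ xs → s′ q + Y q ≡ X q + m
  s′+Y {q} q∈ = trans (+-assoc (X q) _ _) (cong (X q +_) (m∸n+n≡m (Y≤m q∈)))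

  hits : (P → ℕ) → ℕ → ℕ
  hits σ i = ∑ xs λ q → ⟦ σ q ≟ i + m ⟧ + ⟦ σ q ≟ i ⟧

  -- The double count is used with two weights: `const 1` counts the hits, `id` adds up their column
  -- numbers.
  module _ (w : ℕ → ℕ) where

    private
      ∑-col : ∑ I (λ i → w i * col i) ≡ ∑ xs (w ∘ X)
      ∑-col = trans (∑-cong I λ {i} _ → sym (∑-*ˡ xs (w i) _))
        (trans (∑-swap I xs λ i q → w i * ⟦ X q ≟ i ⟧)
        (∑-cong xs λ q∈ → ∑-δ-∈ _≟_ w (upTo⁺ _) (∈I⁺ (X≤m q∈))))

      ∑-end : ∀ {p} → p ∈ xs → ∑ I (λ i → w i * (col i + ⟦ X p ≟ i ⟧)) ≡ ∑ xs (w ∘ X) + w (X p)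
      ∑-end {p} p∈ = trans (∑-*-+ I w col (λ i → ⟦ X p ≟ i ⟧))
        (cong₂ _+_ ∑-col (∑-δ-∈ _≟_ w (upTo⁺ _) (∈I⁺ (X≤m p∈))))

    ∑-ends : ∑ I (λ i → w i * ends i) ≡
             (∑ xs (w ∘ X) + w (X t)) + (∑ xs (w ∘ X) + w (X b))
    ∑-ends = trans
      (∑-*-+ I w (λ i → col i + ⟦ X t ≟ i ⟧) (λ i → col i + ⟦ X b ≟ i ⟧))
      (cong₂ _+_ (∑-end t∈) (∑-end b∈))

    private
      -- The reflection y ↦ m ∸ y turns diagonals into antidiagonals and exchanges the rows.
      rays-crossings : ∀ i → rays i ≡ hits s i + hits s′ i
      rays-crossings i = trans (rearrange (anti i m) _ _ _)
        (cong₂ _+_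
          (trans (cong (λ n → anti i m + ∑ xs λ q → ⟦ s q ≟ n ⟧) (+-identityʳ i)) (sym (∑-+ xs _ _)))
          (trans (cong₂ _+_ (∑-cong xs diag-bottom) (∑-cong xs diag-top)) (sym (∑-+ xs _ _))))
        where
        rearrange : ∀ x y z v → (x + y) + (z + v) ≡ (x + z) + (v + y)
        rearrange = solve-∀

        diag-top : ∀ {q} → q ∈ xs → ⟦ X q + m ≟ i + Y q ⟧ ≡ ⟦ s′ q ≟ i ⟧
        diag-top {q} q∈ = ⟦⟧-cong (X q + m ≟ i + Y q) (s′ q ≟ i)
          (λ eq → +-cancelʳ-≡ (Y q) _ _ (trans (s′+Y q∈) eq))
          (λ eq → trans (sym (s′+Y q∈)) (cong (_+ Y q) eq))

        -- Adding `Y q + i` removes the subtraction hidden in `s′`, so that `diag-bottom` follows by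
        -- cancellation.
        shift : ∀ {q} → q ∈ xs → s′ q + (Y q + i) ≡ (X q + 0) + (i + m)
        shift {q} q∈ = trans (sym (+-assoc (s′ q) _ _))
          (trans (cong (_+ i) (s′+Y q∈)) (reorder (X q) m i))
          where
          reorder : ∀ x n j → x + n + j ≡ (x + 0) + (j + n)
          reorder = solve-∀

        diag-bottom : ∀ {q} → q ∈ xs → ⟦ X q + 0 ≟ i + Y q ⟧ ≡ ⟦ s′ q ≟ i + m ⟧
        diag-bottom {q} q∈ = ⟦⟧-cong (X q + 0 ≟ i + Y q) (s′ q ≟ i + m)
          (λ eq → +-cancelʳ-≡ (Y q + i) _ _ (trans (shift q∈)
            (trans (cong (_+ (i + m)) (trans eq (+-comm i (Y q)))) (+-comm (Y q + i) (i + m)))))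
          (λ eq → +-cancelʳ-≡ (i + m) _ _ (trans (sym (shift q∈))
            (trans (cong (_+ (Y q + i)) eq)
              (trans (+-comm (i + m) (Y q + i)) (cong (_+ (i + m)) (+-comm (Y q) i))))))

      ∑-crossings : ∀ (σ : P → ℕ) →
        ∑ I (λ i → w i * hits σ i) ≡ ∑ xs (λ q → crossings m w (σ q))
      ∑-crossings σ = trans (∑-cong I λ {i} _ → sym (∑-*ˡ xs (w i) _))
        (∑-swap I xs λ i q → w i * (⟦ σ q ≟ i + m ⟧ + ⟦ σ q ≟ i ⟧))

    ∑-rays : ∑ I (λ i → w i * rays i) ≡
             ∑ xs (λ q → crossings m w (s q)) + ∑ xs (λ q → crossings m w (s′ q))
    ∑-rays = trans (∑-cong I λ {i} _ → cong (w i *_) (rays-crossings i))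
      (trans (∑-*-+ I w (hits s) (hits s′)) (cong₂ _+_ (∑-crossings s) (∑-crossings s′)))

  mainAnti mainDiag : ℕ
  mainAnti = ∑ xs λ q → ⟦ s  q ≟ m ⟧
  mainDiag = ∑ xs λ q → ⟦ s′ q ≟ m ⟧

  on-mainDiag : ∀ {q} → q ∈ xs → s′ q ≡ m → X q ≡ Y q
  on-mainDiag {q} q∈ eq =
    +-cancelʳ-≡ m _ _ (trans (sym (s′+Y q∈)) (trans (cong (_+ Y q) eq) (+-comm m (Y q))))

  mainAnti≤1 : mainAnti ≤ 1
  mainAnti≤1 = ∑-⟦⟧-≤1 (λ q → s q ≟ m) xs! λ p∈ q∈ ep eq → anti! p∈ q∈ (trans ep (sym eq))

  mainDiag≤1 : mainDiag ≤ 1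
  mainDiag≤1 = ∑-⟦⟧-≤1 (λ q → s′ q ≟ m) xs! λ {p} {q} p∈ q∈ ep eq →
    diag! p∈ q∈ (trans (cong₂ _+_ (on-mainDiag p∈ ep) (sym (on-mainDiag q∈ eq))) (+-comm (Y p) (X q)))

  private
    ∑ends : ∑ I ends ≡ (k + k) + 2
    ∑ends = trans (∑-cong I λ {i} _ → sym (*-identityˡ (ends i))) (trans (∑-ends (const 1))
      (trans (cong (λ n → (n + 1) + (n + 1)) (trans (∑-const xs 1) (*-identityʳ k))) (regroup k)))
      where
      regroup : ∀ n → (n + 1) + (n + 1) ≡ (n + n) + 2
      regroup = solve-∀

    ∑rays : ∑ I rays ≡ (k + k) + (mainAnti + mainDiag)
    ∑rays = trans (∑-cong I λ {i} _ → sym (*-identityˡ (rays i))) (trans (∑-rays (const 1))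
      (trans (cong₂ _+_ (count s s≤) (count s′ s′≤)) (regroup k mainAnti mainDiag)))
      where
      count : ∀ (σ : P → ℕ) → (∀ {q} → q ∈ xs → σ q ≤ m + m) →
              ∑ xs (λ q → crossings m (const 1) (σ q)) ≡ k + ∑ xs (λ q → ⟦ σ q ≟ m ⟧)
      count σ σ≤ = trans (∑-cong xs λ q∈ → crossings-count {m} (σ≤ q∈))
        (trans (∑-+ xs (const 1) _) (cong (_+ ∑ xs (λ q → ⟦ σ q ≟ m ⟧)) (trans (∑-const xs 1) (*-identityʳ k))))

      regroup : ∀ n x y → (n + x) + (n + y) ≡ (n + n) + (x + y)
      regroup = solve-∀

    -- The total demand `(k + k) + 2` is at most the supply, and only queens on the main diagonals
    -- supply more than one hit per line.
    2≤main : 2 ≤ mainAnti + mainDiag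
    2≤main = +-cancelˡ-≤ (k + k) _ _
      (subst₂ _≤_ ∑ends ∑rays (∑-mono I (ends≤rays ∘ ∈I⁻)))

  mainAnti≥1 : 1 ≤ mainAnti
  mainAnti≥1 = +-cancelʳ-≤ 1 _ _ (≤-trans 2≤main (+-monoʳ-≤ mainAnti mainDiag≤1))

  mainDiag≥1 : 1 ≤ mainDiag
  mainDiag≥1 = +-cancelˡ-≤ 1 _ _ (≤-trans 2≤main (+-monoˡ-≤ mainDiag mainAnti≤1))

  -- Each main diagonal holds at most one queen, so the supply cannot exceed the demand in total
  -- either.
  ends≡rays : ∀ {i} → i ≤ m → ends i ≡ rays i
  ends≡rays i≤m = ∑-tight I (ends≤rays ∘ ∈I⁻)
    (subst₂ _≤_ (sym ∑rays) (sym ∑ends) (+-monoʳ-≤ (k + k) (+-mono-≤ mainAnti≤1 mainDiag≤1)))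
    (∈I⁺ i≤m)

  top-tight : ∀ {i} → i ≤ m → col i + ⟦ X t ≟ i ⟧ ≡ anti i m + diag i m
  top-tight i≤m =
    m+n≡l+o∧m≤l∧n≤o⇒m≡l (top-bound i≤m) (bottom-bound i≤m) (ends≡rays i≤m)

  bottom-tight : ∀ {i} → i ≤ m → col i + ⟦ X b ≟ i ⟧ ≡ anti i 0 + diag i 0
  bottom-tight {i} i≤m =
    +-cancelˡ-≡ (col i + ⟦ X t ≟ i ⟧) _ _
      (trans (ends≡rays i≤m) (cong (_+ (anti i 0 + diag i 0)) (sym (top-tight i≤m))))

  -- Tightness read backwards: a diagonal hit in the top row must be matched by an occupied column.
  column-of-ray : ∀ {i} → i ≤ m → 1 ≤ anti i m + diag i m → ∃[ q ] q ∈ xs × X q ≡ i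
  column-of-ray {i} i≤m pos with X t ≟ i
  ... | yes Xt≡i = t , t∈ , Xt≡i
  ... | no Xt≢i  = ∑-⟦⟧-witness xs (λ q → X q ≟ i) (subst (1 ≤_)
    (trans (sym (top-tight i≤m)) (trans (cong (col i +_) (⟦⟧-no (X t ≟ i) Xt≢i)) (+-identityʳ (col i)))) pos)

  left-queen : ∃[ q ] q ∈ xs × X q ≡ 0
  left-queen with q , q∈ , eq ← ∑-⟦⟧-witness xs (λ q → s q ≟ m) mainAnti≥1 =
    -- The corner (0 , m) lies on the main antidiagonal.
    column-of-ray z≤n (m≤n⇒m≤n+o _ (1≤anti {i = 0} q∈ eq))

  right-queen : ∃[ q ] q ∈ xs × X q ≡ m
  right-queen with q , q∈ , eq ← ∑-⟦⟧-witness xs (λ q → s′ q ≟ m) mainDiag≥1 =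
    -- The corner (m , m) lies on the main diagonal.
    column-of-ray ≤-refl (m≤n⇒m≤o+n _ (1≤diag q∈
      (trans (cong (_+ m) (on-mainDiag q∈ eq)) (+-comm (Y q) m))))

  private
    ∑X : ℕ
    ∑X = ∑ xs X

    -- These lines cross in column `σ q ∸ m` instead of `σ q`, so each costs one `m` in the
    -- comparison with `∑ xs σ`.
    wraps : (P → ℕ) → ℕ
    wraps σ = ∑ xs λ q → ⟦ m <? σ q ⟧

    ∑-crossings-id : ∀ (σ : P → ℕ) → (∀ {q} → q ∈ xs → σ q ≤ m + m) →
      ∑ xs (λ q → crossings m id (σ q)) + m * wraps σ ≡ ∑ xs σ
    ∑-crossings-id σ σ≤ = trans (cong (∑ xs (λ q → crossings m id (σ q)) +_) (sym (∑-*ˡ xs m _)))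
      (trans (sym (∑-+ xs _ _)) (∑-cong xs λ q∈ → crossings-sum {m} (σ≤ q∈)))

    s+s′ : ∑ xs s + ∑ xs s′ ≡ (∑X + ∑X) + k * m
    s+s′ = begin
      ∑ xs s + ∑ xs s′                      ≡⟨ ∑-+ xs s s′ ⟨
      ∑ xs (λ q → s q + s′ q)               ≡⟨ ∑-cong xs (λ {q} q∈ → trans (regroup (X q) (Y q) (m ∸ Y q))
                                                  (cong (X q + X q +_) (m∸n+n≡m (Y≤m q∈)))) ⟩
      ∑ xs (λ q → (X q + X q) + m)          ≡⟨ ∑-+ xs _ _ ⟩
      ∑ xs (λ q → X q + X q) + ∑ xs (const m) ≡⟨ cong₂ _+_ (∑-+ xs X X) (∑-const xs m) ⟩
      (∑X + ∑X) + k * m                     ∎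
      where
      open ≡-Reasoning
      regroup : ∀ x y z → (x + y) + (x + z) ≡ (x + x) + (z + y)
      regroup = solve-∀

    -- Weight the equality of `ends` and `rays` by the column number. The rows cancel between `s`
    -- and `s′`, the columns cancel as `∑X + ∑X`, and besides `X t + X b` only multiples of `m`
    -- remain.
    weighted : m * (wraps s + wraps s′) + (X t + X b) ≡ k * m
    weighted = +-cancelˡ-≡ (∑X + ∑X) _ _ (begin
      (∑X + ∑X) + (m * (wraps s + wraps s′) + (X t + X b))
        ≡⟨ regroup₁ ∑X (X t) (X b) m (wraps s) (wraps s′) ⟩
      ((∑X + X t) + (∑X + X b)) + (m * wraps s + m * wraps s′)
        ≡⟨ cong (_+ (m * wraps s + m * wraps s′)) (trans (sym (∑-ends id))
             (trans (∑-cong I λ {i} i∈ → cong (i *_) (ends≡rays (∈I⁻ i∈))) (∑-rays id))) ⟩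
      (∑ xs (λ q → crossings m id (s q)) + ∑ xs (λ q → crossings m id (s′ q))) + (m * wraps s + m * wraps s′)
        ≡⟨ regroup₂ (∑ xs (λ q → crossings m id (s q))) _ _ _ ⟩
      (∑ xs (λ q → crossings m id (s q)) + m * wraps s) + (∑ xs (λ q → crossings m id (s′ q)) + m * wraps s′)
        ≡⟨ cong₂ _+_ (∑-crossings-id s s≤) (∑-crossings-id s′ s′≤) ⟩
      ∑ xs s + ∑ xs s′
        ≡⟨ s+s′ ⟩
      (∑X + ∑X) + k * m ∎)
      where
      open ≡-Reasoning
      regroup₁ : ∀ x t b n u v → (x + x) + (n * (u + v) + (t + b)) ≡ ((x + t) + (x + b)) + (n * u + n * v)
      regroup₁ = solve-∀
      regroup₂ : ∀ x y z v → (x + y) + (z + v) ≡ (x + z) + (y + v)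
      regroup₂ = solve-∀

    m∣Xt+Xb : m ∣ X t + X b
    m∣Xt+Xb = ∣m+n∣m⇒∣n (subst (m ∣_) (sym weighted) (n∣m*n k)) (m∣m*n (wraps s + wraps s′))

  -- A sum of 0 would put both queens in column 0, a sum of `m + m` both in column `m`; the only
  -- multiple of `m` strictly between is `m`.
  Xt+Xb≡m : t ≢ b → X t + X b ≡ m
  Xt+Xb≡m t≢b = m∣n⇒n≡m m∣Xt+Xb
    (n≢0⇒n>0 λ eq → t≢b (col! t∈ b∈ (trans (m+n≡0⇒m≡0 (X t) eq) (sym (m+n≡0⇒n≡0 (X t) eq)))))
    (≤∧≢⇒< (+-mono-≤ (X≤m t∈) (X≤m b∈)) λ eq → t≢b (col! t∈ b∈
      (trans (m+n≡l+o∧m≤l∧n≤o⇒m≡l (X≤m t∈) (X≤m b∈) eq)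
             (sym (m+n≡l+o∧m≤l∧n≤o⇒m≡l (X≤m b∈) (X≤m t∈) (trans (+-comm (X b) (X t)) eq))))))

-- The cell (0 , X b) is attacked by b along its antidiagonal and by t along its diagonal;
-- tightness on the left side then forces a queen there.
tight-sides⇒⊥ : ∀ {P : Set} {xs : List P} {m X Y} → OddQueens xs m X Y → ∀ {t b l r} →
                t ∈ xs → Y t ≡ m → b ∈ xs → Y b ≡ 0 → l ∈ xs → X l ≡ 0 → r ∈ xs → X r ≡ m →
                t ≢ b → ⊥
tight-sides⇒⊥ {xs = xs} {m} {X} {Y} C {t} {b} {l} {r} t∈ Yt b∈ Yb l∈ Xl r∈ Xr t≢b =
  t≢b (trans (diag! t∈ l∈ t~l) (anti! l∈ b∈ l~b))
  where
  open OddQueens C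
  -- After transposing, the right column is the top row and the left column the bottom row.
  module T = TopBottom (transpose C) r∈ Xr l∈ Xl
  open Lines xs Y X using (anti; diag) renaming (col to row)

  Xt+Xb : X t + X b ≡ m
  Xt+Xb = TopBottom.Xt+Xb≡m C t∈ Yt b∈ Yb t≢b

  two-rays : 2 ≤ anti (X b) 0 + diag (X b) 0
  two-rays = +-mono-≤
    (T.1≤anti {i = X b} {j = 0} b∈ (trans (cong (_+ X b) Yb) (sym (+-identityʳ (X b)))))
    (T.1≤diag {i = X b} {j = 0} t∈ (trans (+-identityʳ (Y t)) (trans Yt
      (trans (sym Xt+Xb) (+-comm (X t) (X b))))))

  Yl : Y l ≡ X b
  Yl with Y l ≟ X b
  ... | yes Yl = Yl
  -- With `l` elsewhere, tightness would equate the two rays with the number of queens in row `X b`,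
  -- which is at most 1.
  ... | no Yl≢ = contradiction (T.col≤1 (X b)) (<⇒≱ (≤-trans two-rays (≤-reflexive
    (trans (sym (T.bottom-tight {X b} (X≤m b∈)))
      (trans (cong (row (X b) +_) (⟦⟧-no (Y l ≟ X b) Yl≢)) (+-identityʳ (row (X b))))))))

  t~l : X t + Y l ≡ X l + Y t
  t~l = trans (cong (X t +_) Yl) (trans Xt+Xb (trans (sym Yt) (cong (_+ Y t) (sym Xl))))

  l~b : X l + Y l ≡ X b + Y b
  l~b = trans (cong₂ _+_ Xl Yl) (trans (sym (+-identityʳ (X b))) (cong (X b +_) (sym Yb)))

-- The pass over top and bottom produces queens in the left and right columns, which allow the same
-- pass on the transposed board.
full-height⇒⊥ : ∀ {P : Set} {xs : List P} {m X Y} → OddQueens xs m X Y → ∀ {t b} →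
                t ∈ xs → Y t ≡ m → b ∈ xs → Y b ≡ 0 → t ≢ b → ⊥
full-height⇒⊥ C t∈ Yt b∈ Yb =
  let l , l∈ , Xl = TopBottom.left-queen  C t∈ Yt b∈ Yb
      r , r∈ , Xr = TopBottom.right-queen C t∈ Yt b∈ Yb
  in tight-sides⇒⊥ C t∈ Yt b∈ Yb l∈ Xl r∈ Xr

-- Choice of the window

minimum : {P : Set} (f : P → ℕ) {xs : List P} → 1 ≤ length xs →
          ∃[ p ] p ∈ xs × (∀ {q} → q ∈ xs → f p ≤ f q)
minimum f {x ∷ xs} _ = argmin f x xs , mem , λ where
    (here refl) → f[argmin]≤f[⊤] {f = f} x xs
    (there q∈)  → All.lookup (f[argmin]≤f[xs] {f = f} x xs) q∈
  where
  mem : argmin f x xs ∈ x ∷ xs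
  mem with argmin-sel f x xs
  ... | inj₁ eq = here eq
  ... | inj₂ p∈ = there p∈

maximum : {P : Set} (f : P → ℕ) {xs : List P} → 1 ≤ length xs →
          ∃[ p ] p ∈ xs × (∀ {q} → q ∈ xs → f q ≤ f p)
maximum f {x ∷ xs} _ = argmax f x xs , mem , λ where
    (here refl) → f[⊥]≤f[argmax] {f = f} x xs
    (there q∈)  → All.lookup (f[xs]≤f[argmax] {f = f} x xs) q∈
  where
  mem : argmax f x xs ∈ x ∷ xs
  mem with argmax-sel f x xs
  ... | inj₁ eq = here eq
  ... | inj₂ p∈ = there p∈

-- Parity is a condition on single cells, so it survives in a smaller window containing all queens.
-- Moving the origin by (c , d) adds the same constant to both sides of every line equation.
restrict : ∀ {P : Set} {xs : List P} {M m c d X Y} {X′ Y′ : P → ℕ} → OddQueens xs M X Y →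
           c + m ≤ M → d + m ≤ M →
           (∀ {q} → q ∈ xs → X q ≡ c + X′ q) → (∀ {q} → q ∈ xs → Y q ≡ d + Y′ q) →
           (∀ {q} → q ∈ xs → X′ q ≤ m) → (∀ {q} → q ∈ xs → Y′ q ≤ m) → OddQueens xs m X′ Y′
restrict {xs = xs} {M} {m} {c} {d} {X} {Y} {X′} {Y′} C c+m≤M d+m≤M X≡ Y≡ X′≤m Y′≤m = record
  { xs!   = xs!
  ; X≤m   = X′≤m
  ; Y≤m   = Y′≤m
  ; col!  = λ p∈ q∈ eq → col! p∈ q∈ (trans (X≡ p∈) (trans (cong (c +_) eq) (sym (X≡ q∈))))
  ; row!  = λ p∈ q∈ eq → row! p∈ q∈ (trans (Y≡ p∈) (trans (cong (d +_) eq) (sym (Y≡ q∈))))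
  ; anti! = λ p∈ q∈ eq → anti! p∈ q∈
      (trans (X+Y p∈) (trans (cong (c + d +_) eq) (sym (X+Y q∈))))
  ; diag! = λ {p} {q} p∈ q∈ eq → diag! p∈ q∈
      (trans (cong₂ _+_ (X≡ p∈) (Y≡ q∈)) (trans (interchange c (X′ p) d (Y′ q))
        (trans (cong (c + d +_) eq)
          (trans (sym (interchange c (X′ q) d (Y′ p))) (sym (cong₂ _+_ (X≡ q∈) (Y≡ p∈)))))))
  ; odd   = λ {i} {j} i≤m j≤m free → subst (λ n → n ≡ 0 ⊎ ∃[ h ] n ≡ 1 + 2 * h) (attackers-shift i j)
      (odd (≤-trans (+-monoʳ-≤ c i≤m) c+m≤M) (≤-trans (+-monoʳ-≤ d j≤m) d+m≤M)
        λ q∈ x y → free q∈ (+-cancelˡ-≡ c _ _ (trans (sym (X≡ q∈)) x))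
                           (+-cancelˡ-≡ d _ _ (trans (sym (Y≡ q∈)) y)))
  }
  where
  open OddQueens C
  module L  = Lines xs X Y
  module L′ = Lines xs X′ Y′

  interchange : ∀ a x b y → (a + x) + (b + y) ≡ (a + b) + (x + y)
  interchange = solve-∀

  X+Y : ∀ {q} → q ∈ xs → X q + Y q ≡ (c + d) + (X′ q + Y′ q)
  X+Y {q} q∈ = trans (cong₂ _+_ (X≡ q∈) (Y≡ q∈)) (interchange c (X′ q) d (Y′ q))

  ≟-shift : ∀ e {a b a′ b′} → a ≡ e + a′ → b ≡ e + b′ → ⟦ a ≟ b ⟧ ≡ ⟦ a′ ≟ b′ ⟧
  ≟-shift e {a′ = a′} {b′} refl refl =
    ⟦⟧-cong (e + a′ ≟ e + b′) (a′ ≟ b′) (+-cancelˡ-≡ e a′ b′) (cong (e +_))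

  attackers-shift : ∀ i j → L.attackers (c + i) (d + j) ≡ L′.attackers i j
  attackers-shift i j = cong₂ _+_
    (cong₂ _+_ (∑-cong xs λ q∈ → ≟-shift c (X≡ q∈) refl) (∑-cong xs λ q∈ → ≟-shift d (Y≡ q∈) refl))
    (cong₂ _+_
      (∑-cong xs λ q∈ → ≟-shift (c + d) (X+Y q∈) (interchange c i d j))
      (∑-cong xs λ {q} q∈ → ≟-shift (c + d)
        (trans (cong (_+ (d + j)) (X≡ q∈)) (interchange c (X′ q) d j))
        (trans (cong (c + i +_) (Y≡ q∈)) (interchange c i d (Y′ q)))))

-- The window gets the height of the bounding box, which puts `t` and `b` on its top and bottom
-- rows; being no wider than high, the box fits in.
tall-box⇒⊥ : ∀ {P : Set} {xs : List P} {M X Y} → OddQueens xs M X Y → ∀ {l r b t} →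
             l ∈ xs → (∀ {q} → q ∈ xs → X l ≤ X q) → r ∈ xs → (∀ {q} → q ∈ xs → X q ≤ X r) →
             b ∈ xs → (∀ {q} → q ∈ xs → Y b ≤ Y q) → t ∈ xs → (∀ {q} → q ∈ xs → Y q ≤ Y t) →
             t ≢ b → X r ∸ X l ≤ Y t ∸ Y b → ⊥
tall-box⇒⊥ {M = M} {X} {Y} C {l} {r} {b} {t} l∈ l-min r∈ r-max b∈ b-min t∈ t-max t≢b W≤H =
  full-height⇒⊥ (restrict C c+H≤M d+H≤M
      (λ q∈ → sym (m+[n∸m]≡n (≤-trans c≤Xl (l-min q∈)))) (λ q∈ → sym (m+[n∸m]≡n (b-min q∈)))
      (λ {q} q∈ → m≤n+o⇒m∸n≤o (X q) c (≤-trans (r-max q∈) Xr≤c+H))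
      (λ q∈ → ∸-monoˡ-≤ (Y b) (t-max q∈)))
    t∈ refl b∈ (n∸n≡0 (Y b)) t≢b
  where
  open OddQueens C

  H c : ℕ
  H = Y t ∸ Y b
  -- Start at the left edge of the box, or further left if the window would stick out of the board
  -- on the right.
  c = X l ⊓ (M ∸ H)

  H≤M : H ≤ M
  H≤M = ≤-trans (m∸n≤m (Y t) (Y b)) (Y≤m t∈)

  c≤Xl : c ≤ X l
  c≤Xl = m⊓n≤m (X l) (M ∸ H)

  c+H≤M : c + H ≤ M
  c+H≤M = ≤-trans (+-monoˡ-≤ H (m⊓n≤n (X l) (M ∸ H))) (≤-reflexive (m∸n+n≡m H≤M))

  d+H≤M : Y b + H ≤ M
  d+H≤M = ≤-trans (≤-reflexive (m+[n∸m]≡n (b-min t∈))) (Y≤m t∈)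

  -- Both candidates for `c` reach far enough: one by `W≤H`, the other because its window ends at
  -- the edge of the board.
  Xr≤c+H : X r ≤ c + H
  Xr≤c+H = subst (X r ≤_) (sym (+-distribʳ-⊓ H (X l) (M ∸ H))) (⊓-glb
    (≤-trans (m≤n+m∸n (X r) (X l)) (+-monoʳ-≤ (X l) W≤H))
    (≤-trans (X≤m r∈) (≤-reflexive (sym (m∸n+n≡m H≤M)))))

-- Ensures that the two extreme queens differ: otherwise all queens would share one row or column.
constant⇒length≤1 : ∀ {P : Set} {xs : List P} (f : P → ℕ) → Unique xs →
                    (∀ {p q} → p ∈ xs → q ∈ xs → f p ≡ f q → p ≡ q) →
                    ∀ {b} → (∀ {q} → q ∈ xs → f b ≤ f q) → (∀ {q} → q ∈ xs → f q ≤ f b) → ¬ 2 ≤ length xs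
constant⇒length≤1 {xs = x ∷ y ∷ xs} f ((x≢y All.∷ _) ∷ _) inj b-min b-max _ =
  x≢y (inj (here refl) (there (here refl))
    (trans (pinch (here refl)) (sym (pinch (there (here refl))))))
  where
  pinch : ∀ {q} → q ∈ x ∷ y ∷ xs → f q ≡ f _
  pinch q∈ = ≤-antisym (b-max q∈) (b-min q∈)
constant⇒length≤1 {xs = _ ∷ []} _ _ _ _ _ (s≤s ())

oddQueens-length : ∀ {P : Set} {xs : List P} {M X Y} → OddQueens xs M X Y → ¬ 2 ≤ length xs
oddQueens-length {X = X} {Y} C 2≤k
  with l , l∈ , l-min ← minimum X (<⇒≤ 2≤k) | r , r∈ , r-max ← maximum X (<⇒≤ 2≤k)
     | b , b∈ , b-min ← minimum Y (<⇒≤ 2≤k) | t , t∈ , t-max ← maximum Y (<⇒≤ 2≤k)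
  with ≤-total (X r ∸ X l) (Y t ∸ Y b)
... | inj₁ W≤H = tall-box⇒⊥ C l∈ l-min r∈ r-max b∈ b-min t∈ t-max
        (λ { refl → constant⇒length≤1 Y xs! row! b-min t-max 2≤k }) W≤H
  where open OddQueens C
... | inj₂ H≤W = tall-box⇒⊥ (transpose C) b∈ b-min t∈ t-max l∈ l-min r∈ r-max
        (λ { refl → constant⇒length≤1 X xs! col! l-min r-max 2≤k }) H≤W
  where open OddQueens C

-- From the Queen graph to coordinates

open import Data.Integer using (+_)

Aligned : (i j x y : ℕ) → Set
Aligned i j x y = x ≡ i ⊎ y ≡ j ⊎ x + y ≡ i + j ⊎ x + j ≡ i + y

alignments : (i j x y : ℕ) → ℕ
alignments i j x y = (⟦ x ≟ i ⟧ + ⟦ y ≟ j ⟧) + (⟦ x + y ≟ i + j ⟧ + ⟦ x + j ≟ i + y ⟧)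

alignments≡0 : ∀ {i j x y} → ¬ Aligned i j x y → alignments i j x y ≡ 0
alignments≡0 {i} {j} {x} {y} none = cong₂ _+_
  (cong₂ _+_ (⟦⟧-no (x ≟ i) (none ∘ inj₁)) (⟦⟧-no (y ≟ j) (none ∘ inj₂ ∘ inj₁)))
  (cong₂ _+_ (⟦⟧-no (x + y ≟ i + j) (none ∘ inj₂ ∘ inj₂ ∘ inj₁))
             (⟦⟧-no (x + j ≟ i + y) (none ∘ inj₂ ∘ inj₂ ∘ inj₂)))

-- Two different lines through a cell meet only there, so no attacker is counted twice by
-- `attackers`.
alignments≡1 : ∀ {i j x y} → ¬ (x ≡ i × y ≡ j) → Aligned i j x y → alignments i j x y ≡ 1
alignments≡1 {i} {j} {x} {y} distinct = λ where
    (inj₁ c)               → count (⟦⟧-yes _ c) (⟦⟧-no _ (c∦r c)) (⟦⟧-no _ (c∦a c)) (⟦⟧-no _ (c∦d c))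
    (inj₂ (inj₁ r))        → count (⟦⟧-no _ λ c → c∦r c r) (⟦⟧-yes _ r) (⟦⟧-no _ (r∦a r)) (⟦⟧-no _ (r∦d r))
    (inj₂ (inj₂ (inj₁ a))) → count (⟦⟧-no _ λ c → c∦a c a) (⟦⟧-no _ λ r → r∦a r a) (⟦⟧-yes _ a) (⟦⟧-no _ (a∦d a))
    (inj₂ (inj₂ (inj₂ d))) → count (⟦⟧-no _ λ c → c∦d c d) (⟦⟧-no _ λ r → r∦d r d) (⟦⟧-no _ λ a → a∦d a d) (⟦⟧-yes _ d)
  where
  count : ∀ {c r a d} → ⟦ x ≟ i ⟧ ≡ c → ⟦ y ≟ j ⟧ ≡ r → ⟦ x + y ≟ i + j ⟧ ≡ a → ⟦ x + j ≟ i + y ⟧ ≡ d →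
          alignments i j x y ≡ (c + r) + (a + d)
  count c r a d = cong₂ _+_ (cong₂ _+_ c r) (cong₂ _+_ a d)

  c∦r : x ≡ i → y ≢ j
  c∦r c r = distinct (c , r)

  c∦a : x ≡ i → x + y ≢ i + j
  c∦a refl a = c∦r refl (+-cancelˡ-≡ x y j a)

  c∦d : x ≡ i → x + j ≢ i + y
  c∦d refl d = c∦r refl (sym (+-cancelˡ-≡ x j y d))

  r∦a : y ≡ j → x + y ≢ i + j
  r∦a refl a = c∦r (+-cancelʳ-≡ y x i a) refl

  r∦d : y ≡ j → x + j ≢ i + y
  r∦d refl d = c∦r (+-cancelʳ-≡ y x i d) refl

  a∦d : x + y ≡ i + j → x + j ≢ i + y
  -- Adding both equations gives `2 * x ≡ 2 * i`.
  a∦d a d = c∦a (*-cancelˡ-≡ x i 2 (+-cancelʳ-≡ (y + j) _ _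
      (trans (regroup x y j) (trans (cong₂ _+_ a d)
        (sym (trans (cong (λ n → 2 * i + n) (+-comm y j)) (regroup i j y))))))) a
    where
    regroup : ∀ u v w → 2 * u + (v + w) ≡ (u + v) + (u + w)
    regroup = solve-∀

-- Integer cells as an origin plus natural offsets

_≟²_ : DecidableEquality (ℤ × ℤ)
_≟²_ = ≡-dec ℤ._≟_ ℤ._≟_

offset-injective : ∀ o {i j} → o ℤ.+ + i ≡ o ℤ.+ + j → i ≡ j
offset-injective o = ℤ.+-injective ∘ ∙-cancelˡ o _ _
  where open GroupProperties (AbelianGroup.group ℤ.+-0-abelianGroup) using (∙-cancelˡ)

-- Adding `x + y` on both sides cancels the origin and every subtraction, leaving an equation of
-- natural numbers.
differences⁻ : ∀ o {i j x y} →
  (o ℤ.+ + i) ℤ.- (o ℤ.+ + x) ≡ (o ℤ.+ + j) ℤ.- (o ℤ.+ + y) → i + y ≡ j + x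
differences⁻ o {i} {j} {x} {y} eq = ℤ.+-injective (begin
  + i ℤ.+ + y                                             ≡⟨ lhs o (+ i) (+ x) (+ y) ⟩
  ((o ℤ.+ + i) ℤ.- (o ℤ.+ + x)) ℤ.+ (+ x ℤ.+ + y)         ≡⟨ cong (ℤ._+ (+ x ℤ.+ + y)) eq ⟩
  ((o ℤ.+ + j) ℤ.- (o ℤ.+ + y)) ℤ.+ (+ x ℤ.+ + y)         ≡⟨ rhs o (+ j) (+ x) (+ y) ⟩
  + j ℤ.+ + x                                             ∎)
  where
  open ≡-Reasoning
  lhs : ∀ o i x y → i ℤ.+ y ≡ ((o ℤ.+ i) ℤ.- (o ℤ.+ x)) ℤ.+ (x ℤ.+ y)
  lhs = ℤ-solve-∀
  rhs : ∀ o j x y → ((o ℤ.+ j) ℤ.- (o ℤ.+ y)) ℤ.+ (x ℤ.+ y) ≡ j ℤ.+ x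
  rhs = ℤ-solve-∀

differences⁺ : ∀ o {i j x y} → i + y ≡ j + x →
  (o ℤ.+ + i) ℤ.- (o ℤ.+ + x) ≡ (o ℤ.+ + j) ℤ.- (o ℤ.+ + y)
differences⁺ o {i} {j} {x} {y} eq = begin
  (o ℤ.+ + i) ℤ.- (o ℤ.+ + x)             ≡⟨ lhs o (+ i) (+ x) (+ y) ⟩
  (+ i ℤ.+ + y) ℤ.- (+ x ℤ.+ + y)         ≡⟨ cong (λ n → + n ℤ.- (+ x ℤ.+ + y)) eq ⟩
  (+ j ℤ.+ + x) ℤ.- (+ x ℤ.+ + y)         ≡⟨ rhs o (+ j) (+ x) (+ y) ⟩
  (o ℤ.+ + j) ℤ.- (o ℤ.+ + y)             ∎
  where
  open ≡-Reasoning
  lhs : ∀ o i x y → (o ℤ.+ i) ℤ.- (o ℤ.+ x) ≡ (i ℤ.+ y) ℤ.- (x ℤ.+ y)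
  lhs = ℤ-solve-∀
  rhs : ∀ o j x y → (j ℤ.+ x) ℤ.- (x ℤ.+ y) ≡ (o ℤ.+ j) ℤ.- (o ℤ.+ y)
  rhs = ℤ-solve-∀

module _ (o : ℤ) {a b a′ b′ : ℤ} {i j x y : ℕ}
  (a≡ : a ≡ o ℤ.+ + i) (b≡ : b ≡ o ℤ.+ + j) (a′≡ : a′ ≡ o ℤ.+ + x) (b′≡ : b′ ≡ o ℤ.+ + y) where

  adjacent⇒aligned : QueenAdjacent (a , b) (a′ , b′) → Aligned i j x y
  adjacent⇒aligned (_ , line) rewrite a≡ | b≡ | a′≡ | b′≡ with line
  ... | inj₁ c               = inj₁ (sym (offset-injective o c))
  ... | inj₂ (inj₁ r)        = inj₂ (inj₁ (sym (offset-injective o r)))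
  ... | inj₂ (inj₂ (inj₁ d)) =
    inj₂ (inj₂ (inj₂ (trans (+-comm x j) (sym (differences⁻ o {i} {j} {x} {y} d)))))
  ... | inj₂ (inj₂ (inj₂ a)) =
    -- An antidiagonal is the diagonal equation with `j` and `y` exchanged.
    inj₂ (inj₂ (inj₁ (trans (+-comm x y) (sym (differences⁻ o {i} {y} {x} {j} a)))))

  aligned⇒adjacent : (a , b) ≢ (a′ , b′) → Aligned i j x y → QueenAdjacent (a , b) (a′ , b′)
  aligned⇒adjacent ne line = ne , lines line
    where
    lines : Aligned i j x y → a ≡ a′ ⊎ b ≡ b′ ⊎ a ℤ.- a′ ≡ b ℤ.- b′ ⊎ a ℤ.- a′ ≡ b′ ℤ.- b
    lines line rewrite a≡ | b≡ | a′≡ | b′≡ with line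
    ... | inj₁ c               = inj₁ (cong (λ n → o ℤ.+ + n) (sym c))
    ... | inj₂ (inj₁ r)        = inj₂ (inj₁ (cong (λ n → o ℤ.+ + n) (sym r)))
    ... | inj₂ (inj₂ (inj₁ a)) =
      inj₂ (inj₂ (inj₂ (differences⁺ o {i} {y} {x} {j} (trans (sym a) (+-comm x y)))))
    ... | inj₂ (inj₂ (inj₂ d)) =
      inj₂ (inj₂ (inj₁ (differences⁺ o {i} {j} {x} {y} (trans (sym d) (+-comm x j)))))

-- One origin and one size for both coordinates keep the window square; `onBoard` makes parity
-- available at each of its cells.
record Window (B : Board) (xs : List (ℤ × ℤ)) : Set where
  field
    origin  : ℤ
    size    : ℕ
    inside  : ∀ {a b} → (a , b) ∈ xs → (origin ℤ.≤ a × a ℤ.≤ origin ℤ.+ + size)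
                                     × (origin ℤ.≤ b × b ℤ.≤ origin ℤ.+ + size)
    onBoard : ∀ {i j} → i ≤ size → j ≤ size → cells B (origin ℤ.+ + i , origin ℤ.+ + j)

-- A crude bound that dominates every coordinate at once.
spread : List (ℤ × ℤ) → ℕ
spread xs = ∑ xs λ (a , b) → ∣ a ∣ + ∣ b ∣

module _ {xs : List (ℤ × ℤ)} {a b : ℤ} (p∈ : (a , b) ∈ xs) where

  private
    both≤ : ∣ a ∣ + ∣ b ∣ ≤ spread xs
    both≤ = ∑-term (λ (a , b) → ∣ a ∣ + ∣ b ∣) p∈

  ∣a∣≤spread : ∣ a ∣ ≤ spread xs
  ∣a∣≤spread = m+n≤o⇒m≤o ∣ a ∣ both≤

  ∣b∣≤spread : ∣ b ∣ ≤ spread xs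
  ∣b∣≤spread = m+n≤o⇒n≤o ∣ a ∣ both≤

i≤+n : ∀ i {n} → ∣ i ∣ ≤ n → i ℤ.≤ + n
i≤+n (+ _)    le = ℤ.+≤+ le
i≤+n -[1+ _ ] _  = ℤ.-≤+

-n≤i : ∀ i {n} → ∣ i ∣ ≤ n → ℤ.- (+ n) ℤ.≤ i
-n≤i (+ _)    _        = ℤ.neg-≤-pos
-n≤i -[1+ _ ] (s≤s le) = ℤ.-≤- le

window : ∀ B {xs} → (∀ {p} → p ∈ xs → cells B p) → Window B xs
window (square (suc n) _) on = record
  { origin  = 1ℤ
  -- The board has `suc n` columns, hence offsets 0 to `n`.
  ; size    = n
  ; inside  = on
  ; onBoard = λ i≤n j≤n → (ℤ.+≤+ (s≤s z≤n) , ℤ.+≤+ (s≤s i≤n)) , (ℤ.+≤+ (s≤s z≤n) , ℤ.+≤+ (s≤s j≤n))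
  }
window quarterPlane {xs} on = record
  { origin  = 1ℤ
  ; size    = spread xs
  ; inside  = λ {a} {b} p∈ →
      (proj₁ (on p∈) , i≤+n a (m≤n⇒m≤1+n (∣a∣≤spread p∈))) ,
      (proj₂ (on p∈) , i≤+n b (m≤n⇒m≤1+n (∣b∣≤spread p∈)))
  ; onBoard = λ _ _ → ℤ.+≤+ (s≤s z≤n) , ℤ.+≤+ (s≤s z≤n)
  }
window plane {xs} _ = record
  -- The window is centred at 0 and reaches from `- K` to `K`.
  { origin  = ℤ.- K
  ; size    = spread xs + spread xs
  ; inside  = λ {a} {b} p∈ →
      (-n≤i a (∣a∣≤spread p∈) , upper (i≤+n a (∣a∣≤spread p∈))) ,
      (-n≤i b (∣b∣≤spread p∈) , upper (i≤+n b (∣b∣≤spread p∈)))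
  ; onBoard = λ _ _ → tt
  }
  where
  K : ℤ
  K = + spread xs

  cancel : ∀ k → k ≡ ℤ.- k ℤ.+ (k ℤ.+ k)
  cancel = ℤ-solve-∀

  upper : ∀ {a} → a ℤ.≤ K → a ℤ.≤ ℤ.- K ℤ.+ (K ℤ.+ K)
  upper a≤K = ℤ.≤-trans a≤K (ℤ.≤-reflexive (cancel K))

offset-≡ : ∀ {o a} → o ℤ.≤ a → a ≡ o ℤ.+ + ∣ a ℤ.- o ∣
offset-≡ {o} {a} o≤a =
  trans (cancel o a) (cong (λ i → o ℤ.+ i) (sym (ℤ.0≤i⇒+∣i∣≡i (ℤ.i≤j⇒0≤j-i o≤a))))
  where
  cancel : ∀ o a → a ≡ o ℤ.+ (a ℤ.- o)
  cancel = ℤ-solve-∀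

offset-≤ : ∀ {o a n} → o ℤ.≤ a → a ℤ.≤ o ℤ.+ + n → ∣ a ℤ.- o ∣ ≤ n
offset-≤ {o} {a} {n} o≤a a≤o+n = ℤ.drop‿+≤+ (begin
  + ∣ a ℤ.- o ∣          ≡⟨ ℤ.0≤i⇒+∣i∣≡i (ℤ.i≤j⇒0≤j-i o≤a) ⟩
  a ℤ.- o                ≤⟨ ℤ.+-monoˡ-≤ (ℤ.- o) a≤o+n ⟩
  (o ℤ.+ + n) ℤ.- o      ≡⟨ cancel o (+ n) ⟩
  + n                    ∎)
  where
  open ℤ.≤-Reasoning
  cancel : ∀ o n → (o ℤ.+ n) ℤ.- o ≡ n
  cancel = ℤ-solve-∀

-- The placement given by an odd independent set

module _ {B : Board} {S : Pred (ℤ × ℤ) 0ℓ} (I : OddIndependent (queenGraph B) S)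
  {xs : List (ℤ × ℤ)} (xs! : Unique xs)
  (xs⇒S : ∀ {p} → p ∈ xs → S p) (S⇒xs : ∀ {p} → S p → p ∈ xs) where

  open OddIndependent I
  open Graph (queenGraph B) using (N)
  open Window (window B (subset ∘ xs⇒S))
  open DecMembership _≟²_ using (_∈?_)

  private
    X Y : ℤ × ℤ → ℕ
    X (a , _) = ∣ a ℤ.- origin ∣
    Y (_ , b) = ∣ b ℤ.- origin ∣

    open Lines xs X Y

    X≡ : ∀ {p} → p ∈ xs → proj₁ p ≡ origin ℤ.+ + X p
    X≡ p∈ = offset-≡ (proj₁ (proj₁ (inside p∈)))

    Y≡ : ∀ {p} → p ∈ xs → proj₂ p ≡ origin ℤ.+ + Y p
    Y≡ p∈ = offset-≡ (proj₁ (proj₂ (inside p∈)))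

    aligned⇒≡ : ∀ {p q} → p ∈ xs → q ∈ xs → Aligned (X p) (Y p) (X q) (Y q) → p ≡ q
    aligned⇒≡ {p} {q} p∈ q∈ line = decidable-stable (p ≟² q) λ p≢q →
      independent (xs⇒S p∈) (xs⇒S q∈)
        (aligned⇒adjacent origin (X≡ p∈) (Y≡ p∈) (X≡ q∈) (Y≡ q∈) p≢q line)

    module _ {i j} (i≤ : i ≤ size) (j≤ : j ≤ size)
      (free : ∀ {q} → q ∈ xs → X q ≡ i → Y q ≢ j) where

      v : ℤ × ℤ
      v = origin ℤ.+ + i , origin ℤ.+ + j

      distinct : ∀ {q} → q ∈ xs → ¬ (X q ≡ i × Y q ≡ j)
      distinct q∈ (x , y) = free q∈ x y

      v≢ : ∀ {q} → q ∈ xs → v ≢ q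
      v≢ q∈ refl = free q∈
        (sym (offset-injective origin (X≡ q∈)))
        (sym (offset-injective origin (Y≡ q∈)))

      -- Each queen is aligned with `v` once if it is listed in `ys` and not at all otherwise, so
      -- exchanging sums counts `ys`.
      attackers-size : ∀ {k} → HasSize (N v ∩ S) k → attackers i j ≡ k
      attackers-size (ys , ys! , refl , ys⇔) = begin
        attackers i j
          ≡⟨ cong₂ _+_ (∑-+ xs (λ q → ⟦ X q ≟ i ⟧) (λ q → ⟦ Y q ≟ j ⟧))
               (∑-+ xs (λ q → ⟦ X q + Y q ≟ i + j ⟧) (λ q → ⟦ X q + j ≟ i + Y q ⟧)) ⟨
        ∑ xs (λ q → ⟦ X q ≟ i ⟧ + ⟦ Y q ≟ j ⟧) + ∑ xs (λ q → ⟦ X q + Y q ≟ i + j ⟧ + ⟦ X q + j ≟ i + Y q ⟧)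
          ≡⟨ ∑-+ xs (λ q → ⟦ X q ≟ i ⟧ + ⟦ Y q ≟ j ⟧) (λ q → ⟦ X q + Y q ≟ i + j ⟧ + ⟦ X q + j ≟ i + Y q ⟧) ⟨
        ∑ xs (λ q → alignments i j (X q) (Y q))
          ≡⟨ ∑-cong xs seen ⟩
        -- Membership in `ys` as a sum of deltas; the factor 1 is the weight expected by `∑-δ-∈`.
        ∑ xs (λ q → ∑ ys λ y → 1 * ⟦ q ≟² y ⟧)
          ≡⟨ ∑-swap xs ys (λ q y → 1 * ⟦ q ≟² y ⟧) ⟩
        ∑ ys (λ y → ∑ xs λ q → 1 * ⟦ q ≟² y ⟧)
          ≡⟨ ∑-cong ys (λ {y} y∈ → trans
               (∑-cong xs λ {q} _ → cong (1 *_) (⟦⟧-cong (q ≟² y) (y ≟² q) sym sym))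
               (∑-δ-∈ _≟²_ (const 1) xs! (S⇒xs (proj₂ (to y∈))))) ⟩
        ∑ ys (const 1)
          ≡⟨ trans (∑-const ys 1) (*-identityʳ (length ys)) ⟩
        length ys ∎
        where
        open ≡-Reasoning

        to : ∀ {y} → y ∈ ys → (N v ∩ S) y
        to {y} = Equivalence.to (ys⇔ y)

        from : ∀ {y} → (N v ∩ S) y → y ∈ ys
        from {y} = Equivalence.from (ys⇔ y)

        seen : ∀ {q} → q ∈ xs → alignments i j (X q) (Y q) ≡ ∑ ys (λ y → 1 * ⟦ q ≟² y ⟧)
        seen {q} q∈ with q ∈? ys
        ... | yes q∈ys = trans
          (alignments≡1 {i} {j} (distinct q∈)
            (adjacent⇒aligned origin refl refl (X≡ q∈) (Y≡ q∈) (proj₂ (proj₁ (to q∈ys)))))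
          (sym (∑-δ-∈ _≟²_ (const 1) ys! q∈ys))
        ... | no q∉ys = trans
          (alignments≡0 {i} {j} λ line → q∉ys (from
            ((subset (xs⇒S q∈) , aligned⇒adjacent origin refl refl (X≡ q∈) (Y≡ q∈) (v≢ q∈) line) , xs⇒S q∈)))
          (sym (∑-δ-∉ _≟²_ (const 1) q∉ys))

      attackers-odd : attackers i j ≡ 0 ⊎ ∃[ h ] attackers i j ≡ 1 + 2 * h
      attackers-odd with emptyOrOdd (onBoard i≤ j≤) (λ v∈S → v≢ (S⇒xs v∈S) refl)
      -- The empty case is the same count, with the empty list as enumeration.
      ... | inj₁ empty = inj₁ (attackers-size
              ([] , [] , refl , λ y → mk⇔ (λ ()) λ y∈ → contradiction y∈ (empty y)))
      ... | inj₂ (k , (h , k≡) , size-k) = inj₂ (h , trans (attackers-size size-k) k≡)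

  oddIndependent⇒oddQueens : OddQueens xs size X Y
  oddIndependent⇒oddQueens = record
    { xs!   = xs!
    ; X≤m   = λ p∈ → let (o≤a , a≤) , _ = inside p∈ in offset-≤ o≤a a≤
    ; Y≤m   = λ p∈ → let _ , (o≤b , b≤) = inside p∈ in offset-≤ o≤b b≤
    ; col!  = λ p∈ q∈ eq → aligned⇒≡ p∈ q∈ (inj₁ (sym eq))
    ; row!  = λ p∈ q∈ eq → aligned⇒≡ p∈ q∈ (inj₂ (inj₁ (sym eq)))
    ; anti! = λ p∈ q∈ eq → aligned⇒≡ p∈ q∈ (inj₂ (inj₂ (inj₁ (sym eq))))
    ; diag! = λ p∈ q∈ eq → aligned⇒≡ p∈ q∈ (inj₂ (inj₂ (inj₂ (sym eq))))
    ; odd   = attackers-odd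
    }

theorem6 : (B : Board) →
    ¬ (Σ[ S ∈ Pred (ℤ × ℤ) 0ℓ ]
    (OddIndependent (queenGraph B) S × (∃[ k ] (2 ≤ k × HasSize S k))))
theorem6 B (S , I , k , 2≤k , xs , xs! , refl , xs⇔S) =
  oddQueens-length (oddIndependent⇒oddQueens I xs!
    (λ {p} → Equivalence.to (xs⇔S p)) (λ {p} → Equivalence.from (xs⇔S p))) 2≤k
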